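{- 1. $\lozenge$ is not eliminable with respect to the class of all frames that are backward, downward and upward confluent; 2. $\square$ is not eliminable with respect to the class of all frames that are forward, backward and upward confluent; 3. $⧫$ is not eliminable with respect to the class of all frames that are backward, downward and upward confluent; 4. $\blacksquare$ is not eliminable with respect to the class of all frames that are forward, backward and upward confluent.
   Context: Syntax. $\mathbf{At}=\{p_i : i\in\mathbb{N}\}$ is a countable set of atoms (enumerated without repetition). The set $\mathbf{Fo}$ of formulas is generated by $A ::= p \mid (A\rightharpoonup A)\mid (A\leftharpoondown A)\mid \top\mid\bot\mid (A\vee A)\mid (A\wedge A)\mid \lozenge A\mid\square A\mid⧫ A\mid\blacksquare A$, with $p\in\mathbf{At}$. Semantics. A frame is a triple $(W,\leq,R)$ where $W\neq\emptyset$, $\leq$ is a preorder (reflexive and transitive relation) on $W$ and $R$ is a binary relation on $W$; $\geq$ is the converse of $\leq$. A valuation is a function $V:\mathbf{At}\to\wp(W)$ such that each $V(p)$ is $\leq$-closed (if $s\in V(p)$ and $s\leq t$ then $t\in V(p)$). A model based on $(W,\leq,R)$ is $(W,\leq,R,V)$ with $V$ a valuation. Satisfaction at $s\in W$: $s\models p$ iff $s\in V(p)$; $s\models\top$; $s\not\models\bot$; $\vee,\wedge$ as usual pointwise; - $s\models A\rightharpoonup B$ iff for all $t\geq s$, $t\not\models A$ or $t\models B$; - $s\models A\leftharpoondown B$ iff there is $t\leq s$ with $t\not\models A$ and $t\models B$; - $s\models\lozenge A$ iff there are $t\leq s$ and $u$ with $tRu$ and $u\models A$; - $s\models\square A$ iff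 for all $t\geq s$ and all $u$, $tRu$ implies $u\models A$; - $s\models⧫ A$ iff for all $t\geq s$ there is $u$ with $tRu$ and $u\models A$; - $s\models\blacksquare A$ iff there is $t\leq s$ such that for all $u$, $tRu$ implies $u\models A$. Composition: $s(R\circ S)t$ iff there is $u$ with $sRu$ and $uSt$. A frame is forward confluent if ${\geq}\circ R\subseteq R\circ{\geq}$; backward confluent if $R\circ{\leq}\subseteq{\leq}\circ R$; downward confluent if ${\leq}\circ R\subseteq R\circ{\leq}$; upward confluent if $R\circ{\geq}\subseteq{\geq}\circ R$. A modal connective $\triangledown\in\{\lozenge,\square,⧫,\blacksquare\}$ is eliminable with respect to a class $\mathcal{C}$ of frames if for every atom $p$ there exists a formula $A$ containing no occurrence of $\triangledown$ such that for every frame in $\mathcal{C}$, every model based on it and every $s\in W$: $s\models\triangledown p$ iff $s\models A$. -}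

module Defs where

open import Data.Empty using () renaming (⊥ to Empty)
open import Data.Nat.Base using (ℕ)
open import Data.Product.Base using (_×_; ∃-syntax)
open import Data.Sum.Base using (_⊎_)
open import Data.Unit.Base using () renaming (⊤ to Unit)
open import Function.Base using (flip)
open import Function.Bundles using (_⇔_)
open import Level using (0ℓ)
open import Relation.Binary.Construct.Composition using (_;_)
open import Relation.Binary.Core using (Rel; _⇒_)
open import Relation.Binary.Definitions using (_Respects_)
open import Relation.Binary.PropositionalEquality.Core using (_≡_)
open import Relation.Binary.Structures using (IsPreorder)
open import Relation.Nullary.Negation.Core using (¬_)
open import Relation.Unary using (Pred)

At : Set
At = ℕ

data Modality : Set where
  ◊ □ ⧫ ■ : Modality

infixr 6 _∧_
infixr 5 _∨_
infixr 4 _⇀_ _↽_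

data Fo : Set where
  atom        : At → Fo
  _⇀_ _↽_     : Fo → Fo → Fo
  ⊤ ⊥         : Fo
  _∨_ _∧_     : Fo → Fo → Fo
  mod         : Modality → Fo → Fo

infix 4 _OccursIn_

_OccursIn_ : Modality → Fo → Set
▽ OccursIn atom p  = Empty
▽ OccursIn (A ⇀ B) = ▽ OccursIn A ⊎ ▽ OccursIn B
▽ OccursIn (A ↽ B) = ▽ OccursIn A ⊎ ▽ OccursIn B
▽ OccursIn ⊤       = Empty
▽ OccursIn ⊥       = Empty
▽ OccursIn (A ∨ B) = ▽ OccursIn A ⊎ ▽ OccursIn B
▽ OccursIn (A ∧ B) = ▽ OccursIn A ⊎ ▽ OccursIn B
▽ OccursIn mod ▼ A = ▽ ≡ ▼ ⊎ ▽ OccursIn A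

record Frame : Set₁ where
  infix 4 _≤_ _≥_
  field
    W          : Set
    inhabitant : W
    _≤_        : Rel W 0ℓ
    isPreorder : IsPreorder _≡_ _≤_
    R          : Rel W 0ℓ

  _≥_ : Rel W 0ℓ
  _≥_ = flip _≤_

record Valuation (F : Frame) : Set₁ where
  open Frame F
  field
    V      : At → Pred W 0ℓ
    closed : ∀ p → V p Respects _≤_

module Satisfaction (F : Frame) (𝒱 : Valuation F) where
  open Frame F
  open Valuation 𝒱

  infix 3 _⊨_

  _⊨_ : W → Fo → Set
  s ⊨ atom p  = V p s
  s ⊨ A ⇀ B   = ∀ t → t ≥ s → ¬ (t ⊨ A) ⊎ (t ⊨ B)
  s ⊨ A ↽ B   = ∃[ t ] t ≤ s × ¬ (t ⊨ A) × (t ⊨ B)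
  s ⊨ ⊤       = Unit
  s ⊨ ⊥       = Empty
  s ⊨ A ∨ B   = (s ⊨ A) ⊎ (s ⊨ B)
  s ⊨ A ∧ B   = (s ⊨ A) × (s ⊨ B)
  s ⊨ mod ◊ A = ∃[ t ] ∃[ u ] t ≤ s × R t u × (u ⊨ A)
  s ⊨ mod □ A = ∀ t → t ≥ s → ∀ u → R t u → u ⊨ A
  s ⊨ mod ⧫ A = ∀ t → t ≥ s → ∃[ u ] R t u × (u ⊨ A)
  s ⊨ mod ■ A = ∃[ t ] t ≤ s × (∀ u → R t u → u ⊨ A)

-- The library's L ; R is composition in diagrammatic order (first L, then R).
ForwardConfluent BackwardConfluent DownwardConfluent UpwardConfluent : Pred Frame 0ℓ
ForwardConfluent  F = let open Frame F in (_≥_ ; R) ⇒ (R ; _≥_)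
BackwardConfluent F = let open Frame F in (R ; _≤_) ⇒ (_≤_ ; R)
DownwardConfluent F = let open Frame F in (_≤_ ; R) ⇒ (R ; _≤_)
UpwardConfluent   F = let open Frame F in (R ; _≥_) ⇒ (_≥_ ; R)

Eliminable : Modality → Pred Frame 0ℓ → Set₁
Eliminable ▽ 𝒞 =
  ∀ (p : At) → ∃[ A ] ¬ (▽ OccursIn A) ×
    (∀ (F : Frame) → 𝒞 F → (𝒱 : Valuation F) → let open Satisfaction F 𝒱 in
      ∀ s → (s ⊨ mod ▽ (atom p)) ⇔ (s ⊨ A))

{-# OPTIONS --safe #-}

-- For each ▽ there is a finite model with an equivalence relation ~ on its points that preserves
-- all ▽-free formulas although ▽ p separates two equivalent points.  Reversing ≤ and complementing
-- the valuation exchanges ◊ with □, ⧫ with ■, ⇀ with ↽, forward with downward and backward with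
-- upward confluence, so the models for ◊ and ⧫ yield those for □ and ■.
module Submission where

open import Defs
open import Data.Fin.Base using (Fin)
open import Data.Fin.Patterns
open import Data.Fin.Properties using (_≟_; all?; any?)
open import Data.List.Base using (List; _∷_; [])
open import Data.List.Membership.DecPropositional using (_∈?_)
open import Data.List.Membership.Propositional using (_∈_)
open import Data.Nat.Base using (ℕ)
open import Data.Product.Base using (_×_; _,_; ∃-syntax)
open import Data.Product.Properties using (≡-dec)
open import Data.Sum.Base using (_⊎_; inj₁; inj₂)
open import Function.Base using (_∘_; flip; _on_)
open import Function.Bundles using (Equivalence)
open import Level using (0ℓ)
open import Relation.Binary.Construct.Composition using (_;_)
import Relation.Binary.Construct.Flip.EqAndOrd as Flip
open import Relation.Binary.Core using (Rel; _⇒_)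
open import Relation.Binary.Definitions using (Decidable; Symmetric; _Respects_)
open import Relation.Binary.PropositionalEquality.Core using (_≡_; refl; sym)
open import Relation.Binary.PropositionalEquality.Properties using (isEquivalence)
open import Relation.Binary.Structures using (IsPreorder)
open import Relation.Nullary.Decidable using
  (Dec; map′; _×-dec_; _⊎-dec_; _→-dec_; from-yes; from-no)
open import Relation.Nullary.Negation.Core using (¬_; contradiction)
import Relation.Unary as U
open import Relation.Unary using (Pred; _∩_; ∁)
open import Relation.Unary.Properties using (∁?)

-- Bisimulations for the `▽`-free fragment and invariance under them.

Covers : {W : Set} → Rel W 0ℓ → Rel W 0ℓ → Rel W 0ℓ
Covers R _~_ s t = ∀ u → R s u → ∃[ v ] R t v × u ~ v

module _ (F : Frame) (_~_ : Rel (Frame.W F) 0ℓ) where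
  open Frame F

  -- For ◊ and □ only the composite with `R` has to be matched: the intermediate points need not be
  -- related. For ⧫ and ■ successors are matched in one direction only, from the point that is found
  -- to the point that is given.
  Preserves : Modality → Set
  Preserves ◊ = (_~_ ; (_≥_ ; R)) ⇒ ((_≥_ ; R) ; _~_)
  Preserves □ = (_~_ ; (_≤_ ; R)) ⇒ ((_≤_ ; R) ; _~_)
  Preserves ⧫ = (_~_ ; _≤_) ⇒ (_≤_ ; Covers R _~_)
  Preserves ■ = (_~_ ; _≥_) ⇒ (_≥_ ; Covers R _~_)

-- The conditions `up` and `down` serve ⇀ and ↽. Each condition is one half of a back-and-forth
-- clause; symmetry supplies the other half. Exempting `▽` itself leaves room for `▽ p` to separate
-- related points.
record Bisimulation (▽ : Modality) (F : Frame) (𝒱 : Valuation F)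
                    (_~_ : Rel (Frame.W F) 0ℓ) : Set where
  open Frame F
  open Valuation 𝒱
  field
    symmetric : Symmetric _~_
    atoms     : ∀ p → V p Respects _~_
    up        : (_~_ ; _≤_) ⇒ (_≤_ ; _~_)
    down      : (_~_ ; _≥_) ⇒ (_≥_ ; _~_)
    preserves : ∀ ▼ → ▽ ≡ ▼ ⊎ Preserves F _~_ ▼

module _ {▽ F 𝒱 _~_} (bisim : Bisimulation ▽ F 𝒱 _~_) where
  open Satisfaction F 𝒱
  open Bisimulation bisim

  -- Induction on the formula. By symmetry the induction hypothesis is an equivalence, as the
  -- negated left arguments of ⇀ and ↽ require.
  invariance : ∀ A → ¬ ▽ OccursIn A → (_⊨ A) Respects _~_

  invariance-mod : ∀ ▼ A → Preserves F _~_ ▼ → ¬ ▽ OccursIn A → (_⊨ mod ▼ A) Respects _~_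
  invariance-mod ◊ A pres free s~s′ (t , u , t≤s , tRu , u⊨A)
    -- The given witness lies below `s`, so the condition is used from `s′` towards `s`; the same
    -- happens for ■.
    with pres (_ , symmetric s~s′ , t , t≤s , tRu)
  ... | u′ , (t′ , t′≤s′ , t′Ru′) , u′~u =
    t′ , u′ , t′≤s′ , t′Ru′ , invariance A free (symmetric u′~u) u⊨A
  invariance-mod □ A pres free s~s′ s⊨□A t′ s′≤t′ u′ t′Ru′
    with pres (_ , s~s′ , t′ , s′≤t′ , t′Ru′)
  ... | u , (t , s≤t , tRu) , u~u′ = invariance A free u~u′ (s⊨□A t s≤t u tRu)
  invariance-mod ⧫ A pres free s~s′ s⊨⧫A t′ s′≤t′
    with pres (_ , s~s′ , s′≤t′)
  ... | t , s≤t , covers with s⊨⧫A t s≤t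
  ...   | u , tRu , u⊨A with covers u tRu
  ...     | u′ , t′Ru′ , u~u′ = u′ , t′Ru′ , invariance A free u~u′ u⊨A
  invariance-mod ■ A pres free s~s′ (t , t≤s , t⊨A)
    with pres (_ , symmetric s~s′ , t≤s)
  ... | t′ , t′≤s′ , covers = t′ , t′≤s′ , λ u′ t′Ru′ →
    let u , tRu , u′~u = covers u′ t′Ru′
    in invariance A free (symmetric u′~u) (t⊨A u tRu)

  invariance (atom p) free s~s′ = atoms p s~s′
  invariance (A ⇀ B) free s~s′ s⊨A⇀B t′ s′≤t′
    with up (_ , s~s′ , s′≤t′)
  -- The disjunction known at `t` is transported to `t′`, so no excluded middle is needed.
  ... | t , s≤t , t~t′ with s⊨A⇀B t s≤t
  ...   | inj₁ t⊭A = inj₁ (t⊭A ∘ invariance A (free ∘ inj₁) (symmetric t~t′))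
  ...   | inj₂ t⊨B = inj₂ (invariance B (free ∘ inj₂) t~t′ t⊨B)
  invariance (A ↽ B) free s~s′ (t , t≤s , t⊭A , t⊨B)
    with down (_ , symmetric s~s′ , t≤s)
  ... | t′ , t′≤s′ , t′~t =
    t′ , t′≤s′ , t⊭A ∘ invariance A (free ∘ inj₁) t′~t
       , invariance B (free ∘ inj₂) (symmetric t′~t) t⊨B
  invariance ⊤ free s~s′ s⊨⊤ = s⊨⊤
  invariance ⊥ free s~s′ ()
  invariance (A ∨ B) free s~s′ (inj₁ s⊨A) = inj₁ (invariance A (free ∘ inj₁) s~s′ s⊨A)
  invariance (A ∨ B) free s~s′ (inj₂ s⊨B) = inj₂ (invariance B (free ∘ inj₂) s~s′ s⊨B)
  invariance (A ∧ B) free s~s′ (s⊨A , s⊨B) =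
    invariance A (free ∘ inj₁) s~s′ s⊨A , invariance B (free ∘ inj₂) s~s′ s⊨B
  invariance (mod ▼ A) free with preserves ▼
  ... | inj₁ ▽≡▼  = contradiction (inj₁ ▽≡▼) free
  ... | inj₂ pres = invariance-mod ▼ A pres (free ∘ inj₂)

  ¬eliminable : ∀ {𝒞 : Pred Frame 0ℓ} {s s′} p → 𝒞 F → s ~ s′ →
                s ⊨ mod ▽ (atom p) → ¬ (s′ ⊨ mod ▽ (atom p)) → ¬ Eliminable ▽ 𝒞
  ¬eliminable p F∈𝒞 s~s′ s⊨▽p s′⊭▽p eliminable with eliminable p
  ... | A , free , equiv =
    s′⊭▽p (Equivalence.from (equiv F F∈𝒞 𝒱 _)
            (invariance A free s~s′ (Equivalence.to (equiv F F∈𝒞 𝒱 _) s⊨▽p)))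

-- Decision procedures on finite frames.

module _ {n : ℕ} {P Q : Rel (Fin n) 0ℓ} (P? : Decidable P) (Q? : Decidable Q) where

  _;?_ : Decidable (P ; Q)
  _;?_ s t = any? λ u → P? s u ×-dec Q? u t

  _⇒?_ : Dec (P ⇒ Q)
  _⇒?_ = map′ (λ f {s} {t} → f s t) (λ f s t → f {s} {t})
           (all? λ s → all? λ t → P? s t →-dec Q? s t)

  covers? : Decidable (Covers P Q)
  covers? s t = all? λ u → P? s u →-dec any? λ v → P? t v ×-dec Q? u v

module _ {n : ℕ} {P : Pred (Fin n) 0ℓ} {Q : Rel (Fin n) 0ℓ}
         (P? : U.Decidable P) (Q? : Decidable Q) where

  respects? : Dec (P Respects Q)
  respects? = map′ (λ f {s} {t} → f s t) (λ f s t → f {s} {t})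
                (all? λ s → all? λ t → Q? s t →-dec (P? s →-dec P? t))

module FiniteFrame {n : ℕ} {_≤_ R : Rel (Fin n) 0ℓ}
                   (point : Fin n) (isPreorder : IsPreorder _≡_ _≤_)
                   (_≤?_ : Decidable _≤_) (R? : Decidable R) where

  frame : Frame
  frame = record { inhabitant = point ; isPreorder = isPreorder ; R = R }

  _≥?_ : Decidable (flip _≤_)
  _≥?_ = flip _≤?_

  forward? : Dec (ForwardConfluent frame)
  forward? = (_≥?_ ;? R?) ⇒? (R? ;? _≥?_)

  backward? : Dec (BackwardConfluent frame)
  backward? = (R? ;? _≤?_) ⇒? (_≤?_ ;? R?)

  downward? : Dec (DownwardConfluent frame)
  downward? = (_≤?_ ;? R?) ⇒? (R? ;? _≤?_)

  upward? : Dec (UpwardConfluent frame)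
  upward? = (R? ;? _≥?_) ⇒? (_≥?_ ;? R?)

  module _ {_~_ : Rel (Fin n) 0ℓ} (_~?_ : Decidable _~_) where

    up? : Dec ((_~_ ; _≤_) ⇒ (_≤_ ; _~_))
    up? = (_~?_ ;? _≤?_) ⇒? (_≤?_ ;? _~?_)

    down? : Dec ((_~_ ; flip _≤_) ⇒ (flip _≤_ ; _~_))
    down? = (_~?_ ;? _≥?_) ⇒? (_≥?_ ;? _~?_)

    preserves? : ∀ ▼ → Dec (Preserves frame _~_ ▼)
    preserves? ◊ = (_~?_ ;? (_≥?_ ;? R?)) ⇒? ((_≥?_ ;? R?) ;? _~?_)
    preserves? □ = (_~?_ ;? (_≤?_ ;? R?)) ⇒? ((_≤?_ ;? R?) ;? _~?_)
    preserves? ⧫ = (_~?_ ;? _≤?_) ⇒? (_≤?_ ;? covers? R? _~?_)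
    preserves? ■ = (_~?_ ;? _≥?_) ⇒? (_≥?_ ;? covers? R? _~?_)

  module _ {P : Pred (Fin n) 0ℓ} (P-closed : P Respects _≤_) (P? : U.Decidable P) where

    -- Refuting eliminability takes a single atom, so all atoms may share one set, and `~` has only
    -- that set to respect.
    constantValuation : Valuation frame
    constantValuation = record { V = λ _ → P ; closed = λ _ → P-closed }

    open Satisfaction frame constantValuation

    ⊨mod-atom? : ∀ s ▼ p → Dec (s ⊨ mod ▼ (atom p))
    ⊨mod-atom? s ◊ p = any? λ t → any? λ u → (t ≤? s) ×-dec R? t u ×-dec P? u
    ⊨mod-atom? s □ p = all? λ t → (s ≤? t) →-dec all? λ u → R? t u →-dec P? u
    ⊨mod-atom? s ⧫ p = all? λ t → (s ≤? t) →-dec any? λ u → R? t u ×-dec P? u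
    ⊨mod-atom? s ■ p = any? λ t → (t ≤? s) ×-dec all? λ u → R? t u →-dec P? u

-- Finite relations given by lists of pairs.

module _ {n : ℕ} where

  Edge : List (Fin n × Fin n) → Rel (Fin n) 0ℓ
  Edge es s t = (s , t) ∈ es

  edge? : ∀ es → Decidable (Edge es)
  edge? es s t = _∈?_ (≡-dec _≟_ _≟_) (s , t) es

  -- Only loops are added. The lists must already be transitive up to loops, hence the pair
  -- `(0F , 2F)` in both orders below.
  ReflClosure : List (Fin n × Fin n) → Rel (Fin n) 0ℓ
  ReflClosure es s t = s ≡ t ⊎ Edge es s t

  reflClosure? : ∀ es → Decidable (ReflClosure es)
  reflClosure? es s t = (s ≟ t) ⊎-dec edge? es s t

  reflClosure-isPreorder : ∀ es → (ReflClosure es ; ReflClosure es) ⇒ ReflClosure es →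
                           IsPreorder _≡_ (ReflClosure es)
  reflClosure-isPreorder es transitive = record
    { isEquivalence = isEquivalence
    ; reflexive     = inj₁
    ; trans         = λ s≤t t≤u → transitive (_ , s≤t , t≤u)
    }

-- The model for ◊ and its reversal for □.

-- The points 2F and 3F have no R-successors; 2F is above 1F, which sees the p-point 5F, whereas
-- strictly below 3F there is only 0F, which sees only 4F.
module ◊-Model where

  order : List (Fin 6 × Fin 6)
  order = (0F , 1F) ∷ (1F , 2F) ∷ (0F , 2F) ∷ (0F , 3F) ∷ (4F , 5F) ∷ []

  -- Forward confluence would make `◊ p` equivalent to `⧫ p`. It fails here because `2F` lies above
  -- points with successors and has none.
  successors : List (Fin 6 × Fin 6)
  successors = (0F , 4F) ∷ (1F , 4F) ∷ (1F , 5F) ∷ []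

  -- To match `1F` below `2F`, the point `3F` has only `0F` to offer, so `0F` and `1F` are
  -- identified. □ reaches `5F` from both by looking up, ■ finds `0F` at or below both, and ⧫ fails
  -- at both because of `2F`. At `2F` and `3F`, which are maximal and see nothing, □ and ■ always
  -- hold and ⧫ never does.
  representative : Fin 6 → Fin 6
  representative 1F = 0F
  representative 3F = 2F
  representative s  = s

  _~_ : Rel (Fin 6) 0ℓ
  _~_ = _≡_ on representative

  _~?_ : Decidable _~_
  s ~? t = representative s ≟ representative t

  isPreorder : IsPreorder _≡_ (ReflClosure order)
  isPreorder = reflClosure-isPreorder order
    (from-yes ((reflClosure? order ;? reflClosure? order) ⇒? reflClosure? order))

  module M = FiniteFrame 0F isPreorder (reflClosure? order) (edge? successors)
  module Mᵈ = FiniteFrame 0F (Flip.isPreorder isPreorder)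
                (flip (reflClosure? order)) (edge? successors)

  P : Pred (Fin 6) 0ℓ
  P = _≡ 5F

  P? : U.Decidable P
  P? s = s ≟ 5F

  P-closed : P Respects ReflClosure order
  P-closed = from-yes (respects? P? (reflClosure? order))

  ∁P-closed : ∁ P Respects flip (ReflClosure order)
  ∁P-closed = from-yes (respects? (∁? P?) (flip (reflClosure? order)))

  bisimulation : Bisimulation ◊ M.frame (M.constantValuation P-closed P?) _~_
  bisimulation = record
    { symmetric = sym
    ; atoms     = λ _ → from-yes (respects? P? _~?_)
    ; up        = from-yes (M.up? _~?_)
    ; down      = from-yes (M.down? _~?_)
    ; preserves = λ where
        ◊ → inj₁ refl
        □ → inj₂ (from-yes (M.preserves? _~?_ □))
        ⧫ → inj₂ (from-yes (M.preserves? _~?_ ⧫))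
        ■ → inj₂ (from-yes (M.preserves? _~?_ ■))
    }

  -- The same `_~_` serves: reversing the order turns the condition for ◊ into the one for □, that
  -- for ⧫ into the one for ■, and `up` into `down`.
  bisimulationᵈ : Bisimulation □ Mᵈ.frame (Mᵈ.constantValuation ∁P-closed (∁? P?)) _~_
  bisimulationᵈ = record
    { symmetric = sym
    ; atoms     = λ _ → from-yes (respects? (∁? P?) _~?_)
    ; up        = from-yes (Mᵈ.up? _~?_)
    ; down      = from-yes (Mᵈ.down? _~?_)
    ; preserves = λ where
        ◊ → inj₂ (from-yes (Mᵈ.preserves? _~?_ ◊))
        □ → inj₁ refl
        ⧫ → inj₂ (from-yes (Mᵈ.preserves? _~?_ ⧫))
        ■ → inj₂ (from-yes (Mᵈ.preserves? _~?_ ■))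
    }

  confluent : (BackwardConfluent ∩ DownwardConfluent ∩ UpwardConfluent) M.frame
  confluent = from-yes (M.backward? ×-dec M.downward? ×-dec M.upward?)

  ◊-¬eliminable : ¬ Eliminable ◊ (BackwardConfluent ∩ DownwardConfluent ∩ UpwardConfluent)
  ◊-¬eliminable = ¬eliminable bisimulation {s = 2F} {s′ = 3F} 0 confluent refl
    (from-yes (M.⊨mod-atom? P-closed P? 2F ◊ 0))
    (from-no (M.⊨mod-atom? P-closed P? 3F ◊ 0))

  confluentᵈ : (ForwardConfluent ∩ BackwardConfluent ∩ UpwardConfluent) Mᵈ.frame
  confluentᵈ = from-yes (Mᵈ.forward? ×-dec Mᵈ.backward? ×-dec Mᵈ.upward?)

  □-¬eliminable : ¬ Eliminable □ (ForwardConfluent ∩ BackwardConfluent ∩ UpwardConfluent)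
  -- `2F` and `3F` trade places: □ of the complement under the reversed order is the negation of ◊.
  □-¬eliminable = ¬eliminable bisimulationᵈ {s = 3F} {s′ = 2F} 0 confluentᵈ refl
    (from-yes (Mᵈ.⊨mod-atom? ∁P-closed (∁? P?) 3F □ 0))
    (from-no (Mᵈ.⊨mod-atom? ∁P-closed (∁? P?) 2F □ 0))

-- The model for ⧫ and its reversal for ■.

-- A chain 0F ≤ 1F ≤ 2F of points that all see 3F, while only 0F and 2F see the p-point 4F:
-- so 2F satisfies ⧫ p and 1F does not.
module ⧫-Model where

  order : List (Fin 5 × Fin 5)
  order = (0F , 1F) ∷ (1F , 2F) ∷ (0F , 2F) ∷ (3F , 4F) ∷ []

  successors : List (Fin 5 × Fin 5)
  successors = (0F , 3F) ∷ (0F , 4F) ∷ (1F , 3F) ∷ (2F , 3F) ∷ (2F , 4F) ∷ []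

  -- `1F` and `2F` can be identified: `0F` lies below both and `2F` at or above both, so ◊ and □
  -- reach `3F` and `4F` from either, while ■ finds at or below either the point `1F`, whose
  -- successors are fewest.
  representative : Fin 5 → Fin 5
  representative 2F = 1F
  representative s  = s

  _~_ : Rel (Fin 5) 0ℓ
  _~_ = _≡_ on representative

  _~?_ : Decidable _~_
  s ~? t = representative s ≟ representative t

  isPreorder : IsPreorder _≡_ (ReflClosure order)
  isPreorder = reflClosure-isPreorder order
    (from-yes ((reflClosure? order ;? reflClosure? order) ⇒? reflClosure? order))

  module M = FiniteFrame 0F isPreorder (reflClosure? order) (edge? successors)
  module Mᵈ = FiniteFrame 0F (Flip.isPreorder isPreorder)
                (flip (reflClosure? order)) (edge? successors)

  P : Pred (Fin 5) 0ℓ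
  P = _≡ 4F

  P? : U.Decidable P
  P? s = s ≟ 4F

  P-closed : P Respects ReflClosure order
  P-closed = from-yes (respects? P? (reflClosure? order))

  ∁P-closed : ∁ P Respects flip (ReflClosure order)
  ∁P-closed = from-yes (respects? (∁? P?) (flip (reflClosure? order)))

  bisimulation : Bisimulation ⧫ M.frame (M.constantValuation P-closed P?) _~_
  bisimulation = record
    { symmetric = sym
    ; atoms     = λ _ → from-yes (respects? P? _~?_)
    ; up        = from-yes (M.up? _~?_)
    ; down      = from-yes (M.down? _~?_)
    ; preserves = λ where
        ◊ → inj₂ (from-yes (M.preserves? _~?_ ◊))
        □ → inj₂ (from-yes (M.preserves? _~?_ □))
        ⧫ → inj₁ refl
        ■ → inj₂ (from-yes (M.preserves? _~?_ ■))
    }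

  bisimulationᵈ : Bisimulation ■ Mᵈ.frame (Mᵈ.constantValuation ∁P-closed (∁? P?)) _~_
  bisimulationᵈ = record
    { symmetric = sym
    ; atoms     = λ _ → from-yes (respects? (∁? P?) _~?_)
    ; up        = from-yes (Mᵈ.up? _~?_)
    ; down      = from-yes (Mᵈ.down? _~?_)
    ; preserves = λ where
        ◊ → inj₂ (from-yes (Mᵈ.preserves? _~?_ ◊))
        □ → inj₂ (from-yes (Mᵈ.preserves? _~?_ □))
        ⧫ → inj₂ (from-yes (Mᵈ.preserves? _~?_ ⧫))
        ■ → inj₁ refl
    }

  confluent : (BackwardConfluent ∩ DownwardConfluent ∩ UpwardConfluent) M.frame
  confluent = from-yes (M.backward? ×-dec M.downward? ×-dec M.upward?)

  ⧫-¬eliminable : ¬ Eliminable ⧫ (BackwardConfluent ∩ DownwardConfluent ∩ UpwardConfluent)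
  ⧫-¬eliminable = ¬eliminable bisimulation {s = 2F} {s′ = 1F} 0 confluent refl
    (from-yes (M.⊨mod-atom? P-closed P? 2F ⧫ 0))
    (from-no (M.⊨mod-atom? P-closed P? 1F ⧫ 0))

  confluentᵈ : (ForwardConfluent ∩ BackwardConfluent ∩ UpwardConfluent) Mᵈ.frame
  confluentᵈ = from-yes (Mᵈ.forward? ×-dec Mᵈ.backward? ×-dec Mᵈ.upward?)

  ■-¬eliminable : ¬ Eliminable ■ (ForwardConfluent ∩ BackwardConfluent ∩ UpwardConfluent)
  -- The points trade places again, as ■ of the complement negates ⧫.
  ■-¬eliminable = ¬eliminable bisimulationᵈ {s = 1F} {s′ = 2F} 0 confluentᵈ refl
    (from-yes (Mᵈ.⊨mod-atom? ∁P-closed (∁? P?) 1F ■ 0))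
    (from-no (Mᵈ.⊨mod-atom? ∁P-closed (∁? P?) 2F ■ 0))

proposition21 : ¬ Eliminable ◊ (BackwardConfluent ∩ DownwardConfluent ∩ UpwardConfluent)
    × ¬ Eliminable □ (ForwardConfluent ∩ BackwardConfluent ∩ UpwardConfluent)
    × ¬ Eliminable ⧫ (BackwardConfluent ∩ DownwardConfluent ∩ UpwardConfluent)
    × ¬ Eliminable ■ (ForwardConfluent ∩ BackwardConfluent ∩ UpwardConfluent)
proposition21 = ◊-Model.◊-¬eliminable , ◊-Model.□-¬eliminable
              , ⧫-Model.⧫-¬eliminable , ⧫-Model.■-¬eliminable
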